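{- Let $\mathcal{R}$ be a collection of routes in which every customer is visited exactly once, and let $R_a=[\ldots,i,0]$ and $R_b=[0,j,\ldots]$ be two distinct routes of $\mathcal{R}$, where $i$ is the last customer of $R_a$ and $j$ is the first customer of $R_b$. Let $\mathcal{R}'$ be the collection obtained from $\mathcal{R}$ by merging $R_a$ and $R_b$ into the single route $[\ldots,i,j,\ldots]$. Then the merge increases GED by the Clarke–Wright saving $s(i,j)$: $$\Delta\operatorname{GED}(i,j):=\operatorname{GED}(G_s,G_{\mathcal{R}'})-\operatorname{GED}(G_s,G_{\mathcal{R}})=w(i,0)+w(0,j)-w(i,j)=s(i,j).$$
   Context: Let $V=\{0,1,\dots,n\}$ ($0$ is the depot, $1,\dots,n$ are the customers), let $E=\{(i,j): i,j\in V,\ i\neq j\}$ be the set of all ordered pairs (directed arcs), and let $w:E\to\mathbb{R}^+$ (positive reals) be symmetric, $w(i,j)=w(j,i)$, and satisfy the triangle inequality. $G_s=(V,E,w)$ is the complete weighted directed graph. A route is a sequence $(0,v_1,\dots,v_{l-1},0)$ that starts and ends at the depot and whose intermediate vertices $v_1,\dots,v_{l-1}$ are customers, with at least one customer. Merging $R_a=(0,\dots,i,0)$ and $R_b=(0,j,\dots,0)$ yields the route $(0,\dots,i,j,\dots,0)$. For a collection $\mathcal{R}$ of routes, $G_{\mathcal{R}}=(V,E_{\mathcal{R}})$ is its routing graph, where $E_{\mathcal{R}}\subseteq E$ is the set of directed arcs traversed by the routes. The graph edit distance, with edge deletion cost $c_{\mathrm{del}}(e)=w(e)$ and edge insertion cost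 $0$, is $\operatorname{GED}(G_s,G_{\mathcal{R}})=\sum_{e\in E\setminus E_{\mathcal{R}}}w(e)$. The Clarke–Wright saving is $s(i,j)=w(i,0)+w(0,j)-w(i,j)$. -}

module Defs where

open import Data.Nat.Base as ℕ using (ℕ; suc; _⊔_)
import Data.Nat.Properties as ℕ
open import Data.Rational.Base as ℚ using (ℚ; 0ℚ; ½)
import Data.Rational.Properties as ℚ
open import Data.Rational.Solver using (module +-*-Solver)
open import Data.Fin.Base using (Fin; zero; suc)
open import Data.Fin.Properties using (_≟_)
open import Data.List.Base as List
  using (List; []; _∷_; _++_; [_]; allFin; cartesianProduct; concatMap; drop; filter; foldr; length; zip)
open import Data.List.NonEmpty.Base as List⁺ using (List⁺; _⁺++⁺_)
import Data.List.Properties as List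
import Data.List.Membership.DecPropositional as DecMembership
open import Data.Product.Base using (_×_; _,_; ∃-syntax; proj₁; proj₂)
import Data.Product.Properties as ×
open import Relation.Binary.Definitions using (DecidableEquality)
open import Relation.Binary.PropositionalEquality using (_≡_; _≢_; refl; cong; subst; sym; trans)
open import Relation.Nullary.Decidable using (¬?; _×-dec_; map′)

-- Real numbers are Cauchy sequences of rationals; equality of reals is the
-- setoid equality _≈_, not _≡_ on sequences.

Eventually : (ℕ → Set) → Set
Eventually P = ∃[ N ] (∀ n → N ℕ.≤ n → P n)

IsCauchy : (ℕ → ℚ) → Set
IsCauchy x = ∀ ε → 0ℚ ℚ.< ε →
  ∃[ N ] (∀ m n → N ℕ.≤ m → N ℕ.≤ n → ℚ.∣ x m ℚ.- x n ∣ ℚ.< ε)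

record ℝ : Set where
  constructor mkℝ
  field
    seq    : ℕ → ℚ
    cauchy : IsCauchy seq

open ℝ public

infix 4 _≈_ _<_ _≤_

_≈_ : ℝ → ℝ → Set
x ≈ y = ∀ ε → 0ℚ ℚ.< ε → Eventually λ n → ℚ.∣ seq x n ℚ.- seq y n ∣ ℚ.< ε

_<_ : ℝ → ℝ → Set
x < y = ∃[ ε ] (0ℚ ℚ.< ε × Eventually λ n → seq x n ℚ.+ ε ℚ.< seq y n)

_≤_ : ℝ → ℝ → Set
x ≤ y = ∀ ε → 0ℚ ℚ.< ε → Eventually λ n → seq x n ℚ.< seq y n ℚ.+ ε

private
  half-pos : ∀ {ε} → 0ℚ ℚ.< ε → 0ℚ ℚ.< ½ ℚ.* ε
  half-pos {ε} 0<ε = subst (ℚ._< ½ ℚ.* ε) (ℚ.*-zeroʳ ½) (ℚ.*-monoʳ-<-pos ½ 0<ε)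

  halves : ∀ ε → ½ ℚ.* ε ℚ.+ ½ ℚ.* ε ≡ ε
  halves ε = trans (sym (ℚ.*-distribʳ-+ ε ½ ½)) (ℚ.*-identityˡ ε)

  +-cauchy : ∀ x y → IsCauchy x → IsCauchy y → IsCauchy (λ n → x n ℚ.+ y n)
  +-cauchy x y cx cy ε 0<ε
    with cx (½ ℚ.* ε) (half-pos 0<ε) | cy (½ ℚ.* ε) (half-pos 0<ε)
  ... | M , hx | N , hy = M ⊔ N , bound
    where
    open ℚ.≤-Reasoning
    open +-*-Solver
    bound : ∀ m n → M ⊔ N ℕ.≤ m → M ⊔ N ℕ.≤ n →
            ℚ.∣ (x m ℚ.+ y m) ℚ.- (x n ℚ.+ y n) ∣ ℚ.< ε
    bound m n p q = begin-strict
      ℚ.∣ (x m ℚ.+ y m) ℚ.- (x n ℚ.+ y n) ∣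
        ≡⟨ cong ℚ.∣_∣ (solve 4 (λ a b c d →
             (a :+ b) :- (c :+ d) := (a :- c) :+ (b :- d)) refl (x m) (y m) (x n) (y n)) ⟩
      ℚ.∣ (x m ℚ.- x n) ℚ.+ (y m ℚ.- y n) ∣
        ≤⟨ ℚ.∣p+q∣≤∣p∣+∣q∣ (x m ℚ.- x n) (y m ℚ.- y n) ⟩
      ℚ.∣ x m ℚ.- x n ∣ ℚ.+ ℚ.∣ y m ℚ.- y n ∣
        <⟨ ℚ.+-mono-< (hx m n (ℕ.m⊔n≤o⇒m≤o M N p) (ℕ.m⊔n≤o⇒m≤o M N q))
                      (hy m n (ℕ.m⊔n≤o⇒n≤o M N p) (ℕ.m⊔n≤o⇒n≤o M N q)) ⟩
      ½ ℚ.* ε ℚ.+ ½ ℚ.* ε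
        ≡⟨ halves ε ⟩
      ε ∎

  neg-cauchy : ∀ x → IsCauchy x → IsCauchy (λ n → ℚ.- x n)
  neg-cauchy x cx ε 0<ε with cx ε 0<ε
  ... | N , h = N , λ m n p q → subst (ℚ._< ε) (∣-∣-neg (x m) (x n)) (h m n p q)
    where
    open +-*-Solver
    ∣-∣-neg : ∀ a b → ℚ.∣ a ℚ.- b ∣ ≡ ℚ.∣ (ℚ.- a) ℚ.- (ℚ.- b) ∣
    ∣-∣-neg a b = trans (sym (ℚ.∣-p∣≡∣p∣ (a ℚ.- b)))
      (cong ℚ.∣_∣ (solve 2 (λ a b → :- (a :- b) := (:- a) :- (:- b)) refl a b))

infixl 6 _+_ _-_
infix  8 -_

0ℝ : ℝ
0ℝ = mkℝ (λ _ → 0ℚ) (λ ε 0<ε → 0 , λ _ _ _ _ → 0<ε)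

_+_ : ℝ → ℝ → ℝ
x + y = mkℝ (λ n → seq x n ℚ.+ seq y n) (+-cauchy (seq x) (seq y) (cauchy x) (cauchy y))

-_ : ℝ → ℝ
- x = mkℝ (λ n → ℚ.- seq x n) (neg-cauchy (seq x) (cauchy x))

_-_ : ℝ → ℝ → ℝ
x - y = x + (- y)

Customer : ℕ → Set
Customer n = Fin n

V : ℕ → Set
V n = Fin (suc n)

depot : ∀ {n} → V n
depot = zero

customer : ∀ {n} → Customer n → V n
customer = suc

Arc : ℕ → Set
Arc n = V n × V n

E : ∀ n → List (Arc n)
E n = filter (λ e → ¬? (proj₁ e ≟ proj₂ e)) (cartesianProduct (allFin (suc n)) (allFin (suc n)))

-- Only the values of w on arcs matter: those on the diagonal are junk,
-- so no axiom constrains them.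
record Weight (n : ℕ) : Set where
  field
    w         : V n → V n → ℝ
    positive  : ∀ {i j} → i ≢ j → 0ℝ < w i j
    symmetric : ∀ {i j} → i ≢ j → w i j ≈ w j i
    triangle  : ∀ {i j k} → i ≢ j → j ≢ k → i ≢ k → w i k ≤ w i j + w j k

-- The route (0, v₁, …, vₗ₋₁, 0) is given by its customers v₁, …, vₗ₋₁.
Route : ℕ → Set
Route n = List⁺ (Customer n)

vertices : ∀ {n} → Route n → List (V n)
vertices r = depot ∷ List.map customer (List⁺.toList r) ++ [ depot ]

arcs : ∀ {n} → Route n → List (Arc n)
arcs r = zip (vertices r) (drop 1 (vertices r))

_≟ᴿ_ : ∀ {n} → DecidableEquality (Route n)
(x List⁺.∷ xs) ≟ᴿ (y List⁺.∷ ys) =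
  map′ (λ { (refl , refl) → refl }) (λ { refl → refl , refl }) (x ≟ y ×-dec List.≡-dec _≟_ xs ys)

merge : ∀ {n} → Route n → Route n → Route n
merge Ra Rb = Ra ⁺++⁺ Rb

Routes : ℕ → Set
Routes n = List (Route n)

visits : ∀ {n} → Routes n → Customer n → ℕ
visits R c = length (filter (c ≟_) (concatMap List⁺.toList R))

VisitsEachOnce : ∀ {n} → Routes n → Set
VisitsEachOnce {n} R = ∀ (c : Customer n) → visits R c ≡ 1

-- (R ∖ {Ra, Rb}) ∪ {merge Ra Rb}. If every customer is visited exactly
-- once then R has no repeated routes, so the filter drops one copy of each.
mergeIn : ∀ {n} → Routes n → Route n → Route n → Routes n
mergeIn R Ra Rb = merge Ra Rb ∷ filter (λ r → ¬? (r ≟ᴿ Ra) ×-dec ¬? (r ≟ᴿ Rb)) R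

routingArcs : ∀ {n} → Routes n → List (Arc n)
routingArcs = concatMap arcs

module _ {n : ℕ} (W : Weight n) where
  open Weight W
  open DecMembership (×.≡-dec (_≟_ {suc n}) (_≟_ {suc n})) using (_∉?_)

  -- The distance from the complete graph to (V , F), where deleting an arc
  -- costs its weight and inserting one is free: the sum of w over E ∖ F.
  -- E lists each arc once, and F matters only through membership.
  GED : List (Arc n) → ℝ
  GED F = foldr (λ e acc → w (proj₁ e) (proj₂ e) + acc) 0ℝ (filter (_∉? F) (E n))

  ΔGED : Routes n → Routes n → ℝ
  ΔGED R R′ = GED (routingArcs R′) - GED (routingArcs R)

  saving : V n → V n → ℝ
  saving i j = w i depot + w depot j - w i j

{-# OPTIONS --safe #-}

-- Write a = (i , 0), b = (0 , j) and x = (i , j), and let F and F′ be the arc sets before and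
-- after the merge. Since no customer is shared by two routes, x ∉ F and a, b ∉ F′, and
-- F ∪ {x} = F′ ∪ {a , b}. With K the set of arcs outside this union, E ∖ F = K ∪ {x} and
-- E ∖ F′ = K ∪ {a , b}, so the two distances differ by w a + w b - w x.
module Submission where

open import Defs
open import Data.Nat.Base using (ℕ)
open import Data.List.NonEmpty.Base using (head; last)
open import Data.List.Membership.Propositional using (_∈_)
open import Data.Product.Base using (_×_)
open import Relation.Binary.PropositionalEquality using (_≡_; _≢_)

open import Data.Fin.Properties using (_≟_; suc-injective)
open import Data.List.Base as List
  using (List; []; _∷_; _++_; [_]; concatMap; drop; filter; foldr; length; zip)
import Data.List.Membership.DecPropositional as DecMembership
open import Data.List.Membership.Propositional using (_∉_; find; lose)
open import Data.List.Membership.Propositional.Properties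
  using (∈-++⁺ˡ; ∈-++⁺ʳ; ∈-++⁻; ∈-map⁻; ∈-filter⁺; ∈-filter⁻; ∈-concatMap⁺; ∈-concatMap⁻;
         ∈-cartesianProduct⁺; ∈-allFin)
open import Data.List.Membership.Propositional.Properties.WithK using (unique∧set⇒bag)
open import Data.List.NonEmpty.Base as List⁺ using (toList; snocView; _∷ʳ′_)
import Data.List.Properties as List
open import Data.List.Relation.Binary.BagAndSetEquality using (∼bag⇒↭)
open import Data.List.Relation.Binary.Permutation.Propositional
  using (_↭_; ↭-reflexive; ↭-trans; ↭-prep; ↭⇒↭ₛ)
open import Data.List.Relation.Binary.Permutation.Propositional.Properties using (map⁺)
open import Data.List.Relation.Binary.Permutation.Setoid.Properties using (foldr-commMonoid)
open import Data.List.Relation.Binary.Subset.Propositional using (_⊆_)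
open import Data.List.Relation.Unary.All.Properties using (¬Any⇒All¬)
open import Data.List.Relation.Unary.AllPairs using (_∷_)
open import Data.List.Relation.Unary.Any using (here; there)
open import Data.List.Relation.Unary.Unique.Propositional using (Unique)
import Data.List.Relation.Unary.Unique.Propositional.Properties as Unique
import Data.Nat.Base as ℕ
import Data.Nat.Properties as ℕ
open import Data.Product.Base using (_,_; ∃-syntax; proj₁; proj₂)
import Data.Product.Properties as ×
open import Data.Rational.Base as ℚ using (ℚ; 0ℚ)
import Data.Rational.Properties as ℚ
open import Data.Rational.Solver using (module +-*-Solver)
open import Data.Sum.Base using (inj₁; inj₂)
open import Function.Base using (_∘_)
open import Function.Bundles using (mk⇔)
open import Relation.Binary.Definitions using (DecidableEquality)
open import Relation.Binary.PropositionalEquality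
  using (refl; sym; trans; cong; cong₂; subst; setoid; module ≡-Reasoning)
open import Relation.Nullary using (yes; no; ¬?; contradiction)
open import Relation.Nullary.Decidable using (_×-dec_)

-- Complements inside a duplicate-free list.

module Complement {A : Set} (_≟ᴬ_ : DecidableEquality A) {U : List A} (unique : Unique U) where
  open DecMembership _≟ᴬ_ using (_∈?_; _∉?_)

  complement : List A → List A
  complement F = filter (_∉? F) U

  -- Both sides are duplicate-free with the same members, hence equal as bags. Only a permutation
  -- results, because `x` may sit anywhere in `U`.
  complement-∷ : ∀ {x F} → x ∈ U → x ∉ F → complement F ↭ x ∷ complement (x ∷ F)
  complement-∷ {x} {F} x∈U x∉F = ∼bag⇒↭ (unique∧set⇒bag
    (Unique.filter⁺ (_∉? F) unique)
    (¬Any⇒All¬ _ (λ x∈ → proj₂ (∈-filter⁻ (_∉? (x ∷ F)) {xs = U} x∈) (here refl))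
      ∷ Unique.filter⁺ (_∉? (x ∷ F)) unique)
    (mk⇔ to from))
    where
    to : complement F ⊆ x ∷ complement (x ∷ F)
    to {y} y∈ with ∈-filter⁻ (_∉? F) {xs = U} y∈ | y ≟ᴬ x
    ... | _         | yes y≡x = here y≡x
    ... | y∈U , y∉F | no  y≢x = there (∈-filter⁺ (_∉? (x ∷ F)) y∈U λ where
      (here y≡x)  → y≢x y≡x
      (there y∈F) → y∉F y∈F)
    from : x ∷ complement (x ∷ F) ⊆ complement F
    from (here refl) = ∈-filter⁺ (_∉? F) x∈U x∉F
    from (there y∈) with ∈-filter⁻ (_∉? (x ∷ F)) {xs = U} y∈
    ... | y∈U , y∉ = ∈-filter⁺ (_∉? F) y∈U (y∉ ∘ there)

  complement-cong : ∀ {F G} → F ⊆ G → G ⊆ F → complement F ≡ complement G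
  complement-cong {F} {G} F⊆G G⊆F =
    List.filter-≐ (_∉? F) (_∉? G) ((λ ∉F → ∉F ∘ G⊆F) , (λ ∉G → ∉G ∘ F⊆G)) U

E-unique : ∀ n → Unique (E n)
E-unique n = Unique.filter⁺ (λ e → ¬? (proj₁ e ≟ proj₂ e)) (Unique.cartesianProduct⁺ (Unique.allFin⁺ _) (Unique.allFin⁺ _))

∈-E : ∀ {n} {u v : V n} → u ≢ v → (u , v) ∈ E n
∈-E u≢v = ∈-filter⁺ (λ e → ¬? (proj₁ e ≟ proj₂ e)) (∈-cartesianProduct⁺ (∈-allFin _) (∈-allFin _)) u≢v

-- Consecutive pairs of a list.

module _ {A : Set} where

  steps : List A → List (A × A)
  steps xs = zip xs (drop 1 xs)

  -- The cut element `z` is kept in both pieces, so neither pair next to it is lost.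
  steps-++ : ∀ xs {z} ys → steps (xs ++ z ∷ ys) ≡ steps (xs ++ [ z ]) ++ steps (z ∷ ys)
  steps-++ []           ys = refl
  steps-++ (x ∷ [])     ys = refl
  steps-++ (x ∷ y ∷ xs) ys = cong ((x , y) ∷_) (steps-++ (y ∷ xs) ys)

  ∈-steps-source : ∀ xs {u v z} → (u , v) ∈ steps (xs ++ [ z ]) → u ∈ xs
  ∈-steps-source (x ∷ [])     (here refl) = here refl
  ∈-steps-source (x ∷ y ∷ xs) (here refl) = here refl
  ∈-steps-source (x ∷ y ∷ xs) (there p)   = there (∈-steps-source (y ∷ xs) p)

  ∈-steps-target : ∀ xs {u v z} → (u , v) ∈ steps (z ∷ xs) → v ∈ xs
  ∈-steps-target (x ∷ xs) (here refl) = here refl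
  ∈-steps-target (x ∷ xs) (there p)   = there (∈-steps-target xs p)

-- Arcs of a tour and visits to customers.

module _ {n : ℕ} where

  -- `arcs r` is `tour (toList r)` by definition; the version on plain lists can be cut at any
  -- customer.
  tour : List (Customer n) → List (Arc n)
  tour cs = steps (depot ∷ List.map customer cs ++ [ depot ])

  outbound : List (Customer n) → Customer n → List (Arc n)
  outbound cs i = steps (depot ∷ List.map customer (cs ++ [ i ]))

  inbound : Customer n → List (Customer n) → List (Arc n)
  inbound j cs = steps (List.map customer (j ∷ cs) ++ [ depot ])

  -- Taking `cs` empty isolates the return arc from `i`; taking `cs` to start with `j` puts the arc
  -- from `i` to `j` at the front of the inbound part.
  tour-++ : ∀ as i cs → tour (as ++ i ∷ cs) ≡ outbound as i ++ inbound i cs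
  tour-++ as i cs = begin
    steps (depot ∷ List.map customer (as ++ i ∷ cs) ++ [ depot ])
      ≡⟨ cong (λ xs → steps (depot ∷ xs ++ [ depot ])) (List.map-++ customer as (i ∷ cs)) ⟩
    steps (depot ∷ (List.map customer as ++ customer i ∷ List.map customer cs) ++ [ depot ])
      ≡⟨ cong (λ xs → steps (depot ∷ xs)) (List.++-assoc (List.map customer as) _ _) ⟩
    steps (depot ∷ List.map customer as ++ customer i ∷ List.map customer cs ++ [ depot ])
      ≡⟨ steps-++ (depot ∷ List.map customer as) _ ⟩
    steps (depot ∷ List.map customer as ++ [ customer i ]) ++ inbound i cs
      ≡⟨ cong (λ xs → steps (depot ∷ xs) ++ inbound i cs) (List.map-++ customer as [ i ]) ⟨
    outbound as i ++ inbound i cs ∎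
    where open ≡-Reasoning

  ∈-map-customer : ∀ {c : Customer n} {cs} → customer c ∈ List.map customer cs → c ∈ cs
  ∈-map-customer c∈ with ∈-map⁻ customer c∈
  ... | _ , c∈cs , refl = c∈cs

  depot∉map-customer : ∀ {cs : List (Customer n)} → depot ∉ List.map customer cs
  depot∉map-customer d∈ with ∈-map⁻ customer d∈
  ... | _ , _ , ()

  ∈-tour-source : ∀ {cs c v} → (customer c , v) ∈ tour cs → c ∈ cs
  ∈-tour-source {cs} p with ∈-steps-source (depot ∷ List.map customer cs) p
  ... | there c∈ = ∈-map-customer c∈

  ∈-tour-target : ∀ {cs u c} → (u , customer c) ∈ tour cs → c ∈ cs
  ∈-tour-target {cs} p with ∈-++⁻ (List.map customer cs) (∈-steps-target _ p)
  ... | inj₁ c∈ = ∈-map-customer c∈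
  ... | inj₂ (here ())

  depot-∉-outbound : ∀ {as i u} → (u , depot) ∉ outbound as i
  depot-∉-outbound p = depot∉map-customer (∈-steps-target _ p)

  depot-∉-inbound : ∀ {j bs v} → (depot , v) ∉ inbound j bs
  depot-∉-inbound {j} {bs} p = depot∉map-customer (∈-steps-source (List.map customer (j ∷ bs)) p)

  visits-∷ : ∀ r (R : Routes n) c →
    visits (r ∷ R) c ≡ length (filter (c ≟_) (toList r)) ℕ.+ visits R c
  visits-∷ r R c = trans (cong length (List.filter-++ (c ≟_) (toList r) (concatMap toList R)))
                         (List.length-++ (filter (c ≟_) (toList r)))

  visits-positive : ∀ {r} {R : Routes n} {c} → r ∈ R → c ∈ toList r → 1 ℕ.≤ visits R c
  visits-positive r∈R c∈r = List.filter-some _ (∈-concatMap⁺ toList (lose r∈R c∈r))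

  visited-twice : ∀ {r s} {R : Routes n} {c} → c ∈ toList r → s ∈ R → c ∈ toList s →
    2 ℕ.≤ visits (r ∷ R) c
  visited-twice {r} {R = R} {c} c∈r s∈R c∈s = subst (2 ℕ.≤_) (sym (visits-∷ r R c))
    (ℕ.+-mono-≤ (List.filter-some (c ≟_) c∈r) (visits-positive s∈R c∈s))

  -- If one of the two routes is the head and the other lies in the tail, `c` is counted twice. The
  -- bound is `≤ 1` because the induction passes to the tail, where the count may drop to 0.
  shared⇒≡ : ∀ {R : Routes n} {c r s} → visits R c ℕ.≤ 1 →
    r ∈ R → s ∈ R → c ∈ toList r → c ∈ toList s → r ≡ s
  shared⇒≡ _  (here refl) (here refl) _   _   = refl
  shared⇒≡ ≤1 (here refl) (there s∈R) c∈r c∈s =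
    contradiction ≤1 (ℕ.<⇒≱ (visited-twice c∈r s∈R c∈s))
  shared⇒≡ ≤1 (there r∈R) (here refl) c∈r c∈s =
    contradiction ≤1 (ℕ.<⇒≱ (visited-twice c∈s r∈R c∈r))
  shared⇒≡ {t ∷ R} {c} ≤1 (there r∈R) (there s∈R) =
    shared⇒≡ (ℕ.m+n≤o⇒n≤o _ (subst (ℕ._≤ 1) (visits-∷ t R c) ≤1)) r∈R s∈R

  toList-last : ∀ (r : Route n) → ∃[ cs ] toList r ≡ cs ++ [ last r ]
  -- `last` is itself defined through `snocView`, so this match computes it; splitting the prefix
  -- then lets `∷ʳ` reduce.
  toList-last r with snocView r
  ... | []       ∷ʳ′ i = [] , refl
  ... | (c ∷ cs) ∷ʳ′ i = c ∷ cs , refl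

  ∈-routingArcs⁺ : ∀ {e r} {R : Routes n} → r ∈ R → e ∈ arcs r → e ∈ routingArcs R
  ∈-routingArcs⁺ r∈R e∈r = ∈-concatMap⁺ arcs (lose r∈R e∈r)

  ∈-routingArcs⁻ : ∀ {e} (R : Routes n) → e ∈ routingArcs R → ∃[ r ] (r ∈ R × e ∈ arcs r)
  ∈-routingArcs⁻ R e∈R = find (∈-concatMap⁻ arcs {xs = R} e∈R)

-- Arc sets before and after the merge.

module MergedArcs {n : ℕ} {R : Routes n} (once : VisitsEachOnce R)
  {Ra Rb : Route n} (Ra∈R : Ra ∈ R) (Rb∈R : Rb ∈ R) (Ra≢Rb : Ra ≢ Rb) where

  i j : Customer n
  i = last Ra
  j = head Rb

  as bs : List (Customer n)
  as = proj₁ (toList-last Ra)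
  bs = List⁺.tail Rb

  F F′ : List (Arc n)
  F  = routingArcs R
  F′ = routingArcs (mergeIn R Ra Rb)

  other? = λ r → ¬? (r ≟ᴿ Ra) ×-dec ¬? (r ≟ᴿ Rb)

  arcs-Ra : arcs Ra ≡ outbound as i ++ [ customer i , depot ]
  arcs-Ra = trans (cong tour (proj₂ (toList-last Ra))) (tour-++ as i [])

  arcs-merge : arcs (merge Ra Rb) ≡ outbound as i ++ (customer i , customer j) ∷ inbound j bs
  arcs-merge = trans (cong tour (begin
    toList Ra ++ toList Rb     ≡⟨ cong (_++ toList Rb) (proj₂ (toList-last Ra)) ⟩
    (as ++ [ i ]) ++ toList Rb ≡⟨ List.++-assoc as [ i ] (toList Rb) ⟩
    as ++ i ∷ toList Rb        ∎))
    (tour-++ as i (toList Rb))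
    where open ≡-Reasoning

  i∈Ra : i ∈ toList Ra
  i∈Ra = subst (i ∈_) (sym (proj₂ (toList-last Ra))) (∈-++⁺ʳ as (here refl))

  j∈Rb : j ∈ toList Rb
  j∈Rb = here refl

  shared : ∀ {c r s} → r ∈ R → s ∈ R → c ∈ toList r → c ∈ toList s → r ≡ s
  shared {c} = shared⇒≡ (ℕ.≤-reflexive (once c))

  i∉Rb : i ∉ toList Rb
  i∉Rb = Ra≢Rb ∘ shared Ra∈R Rb∈R i∈Ra

  j∉Ra : j ∉ toList Ra
  j∉Ra j∈Ra = Ra≢Rb (shared Ra∈R Rb∈R j∈Ra j∈Rb)

  outbound⊆Ra : outbound as i ⊆ arcs Ra
  outbound⊆Ra e∈ = subst (_ ∈_) (sym arcs-Ra) (∈-++⁺ˡ e∈)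

  outbound⊆merge : outbound as i ⊆ arcs (merge Ra Rb)
  outbound⊆merge e∈ = subst (_ ∈_) (sym arcs-merge) (∈-++⁺ˡ e∈)

  inbound⊆merge : (customer i , customer j) ∷ inbound j bs ⊆ arcs (merge Ra Rb)
  inbound⊆merge e∈ = subst (_ ∈_) (sym arcs-merge) (∈-++⁺ʳ (outbound as i) e∈)

  -- The origins of an arc of `F′`: three stretches of the merged route, or a route untouched by the
  -- merge.
  data ∈F′ (e : Arc n) : Set where
    on-outbound : e ∈ outbound as i → ∈F′ e
    on-bridge   : e ≡ (customer i , customer j) → ∈F′ e
    on-inbound  : e ∈ inbound j bs → ∈F′ e
    on-other    : ∀ {r} → r ∈ R → r ≢ Ra → r ≢ Rb → e ∈ arcs r → ∈F′ e

  ∈F′-view : ∀ {e} → e ∈ F′ → ∈F′ e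
  ∈F′-view {e} e∈F′ with ∈-++⁻ (arcs (merge Ra Rb)) e∈F′
  ... | inj₁ e∈m with ∈-++⁻ (outbound as i) (subst (e ∈_) arcs-merge e∈m)
  ...   | inj₁ e∈         = on-outbound e∈
  ...   | inj₂ (here e≡)  = on-bridge e≡
  ...   | inj₂ (there e∈) = on-inbound e∈
  ∈F′-view e∈F′ | inj₂ e∈rest with ∈-routingArcs⁻ (filter other? R) e∈rest
  ... | r , r∈ , e∈r with ∈-filter⁻ other? {xs = R} r∈
  ...   | r∈R , r≢Ra , r≢Rb = on-other r∈R r≢Ra r≢Rb e∈r

  -- A route using this arc would visit both `i` and `j`, so it would equal both `Ra` and `Rb`.
  bridge∉F : (customer i , customer j) ∉ F
  bridge∉F e∈F with ∈-routingArcs⁻ R e∈F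
  ... | r , r∈R , e∈r = Ra≢Rb (trans
    (shared Ra∈R r∈R i∈Ra (∈-tour-source e∈r))
    (shared r∈R Rb∈R (∈-tour-target e∈r) j∈Rb))

  -- No untouched route visits `i`. In the merged route, outbound arcs and the bridge end at
  -- customers, while inbound arcs leave customers of `Rb`.
  last-arc∉F′ : (customer i , depot) ∉ F′
  last-arc∉F′ e∈F′ with ∈F′-view e∈F′
  ... | on-outbound e∈             = depot-∉-outbound e∈
  -- `arcs Rb` reduces to the arc from the depot to `j` followed by `inbound j bs`; hence the
  -- `there`.
  ... | on-inbound e∈              = i∉Rb (∈-tour-source {cs = toList Rb} (there e∈))
  ... | on-other r∈R r≢Ra r≢Rb e∈r = r≢Ra (shared r∈R Ra∈R (∈-tour-source e∈r) i∈Ra)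

  -- The mirror image, tracing targets: outbound arcs end in `Ra`, while inbound arcs and the bridge
  -- leave customers.
  first-arc∉F′ : (depot , customer j) ∉ F′
  first-arc∉F′ e∈F′ with ∈F′-view e∈F′
  ... | on-outbound e∈             = j∉Ra (∈-tour-target (outbound⊆Ra e∈))
  ... | on-inbound e∈              = depot-∉-inbound e∈
  ... | on-other r∈R r≢Ra r≢Rb e∈r = r≢Rb (shared r∈R Rb∈R (∈-tour-target e∈r) j∈Rb)

  before⊆after : (customer i , customer j) ∷ F
               ⊆ (customer i , depot) ∷ (depot , customer j) ∷ F′
  before⊆after (here refl) = there (there (∈-++⁺ˡ (inbound⊆merge (here refl))))
  before⊆after {e} (there e∈F) with ∈-routingArcs⁻ R e∈F
  ... | r , r∈R , e∈r with r ≟ᴿ Ra | r ≟ᴿ Rb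
  ... | yes refl | _ with ∈-++⁻ (outbound as i) (subst (e ∈_) arcs-Ra e∈r)
  ...   | inj₁ e∈        = there (there (∈-++⁺ˡ (outbound⊆merge e∈)))
  ...   | inj₂ (here e≡) = here e≡
  -- The first arc of `Rb` is the extra arc into `j`; all its later arcs survive in the merged
  -- route.
  before⊆after (there _) | r , r∈R , here e≡  | no _ | yes refl = there (here e≡)
  before⊆after (there _) | r , r∈R , there e∈ | no _ | yes refl =
    there (there (∈-++⁺ˡ (inbound⊆merge (there e∈))))
  before⊆after (there _) | r , r∈R , e∈r | no r≢Ra | no r≢Rb =
    there (there (∈-++⁺ʳ (arcs (merge Ra Rb))
      (∈-routingArcs⁺ (∈-filter⁺ other? r∈R (r≢Ra , r≢Rb)) e∈r)))

  after⊆before : (customer i , depot) ∷ (depot , customer j) ∷ F′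
               ⊆ (customer i , customer j) ∷ F
  after⊆before (here refl) = there (∈-routingArcs⁺ Ra∈R
    (subst ((customer i , depot) ∈_) (sym arcs-Ra) (∈-++⁺ʳ (outbound as i) (here refl))))
  after⊆before (there (here refl)) = there (∈-routingArcs⁺ Rb∈R (here refl))
  after⊆before (there (there e∈F′)) with ∈F′-view e∈F′
  ... | on-outbound e∈       = there (∈-routingArcs⁺ Ra∈R (outbound⊆Ra e∈))
  ... | on-bridge e≡         = here e≡
  ... | on-inbound e∈        = there (∈-routingArcs⁺ Rb∈R (there e∈))
  ... | on-other r∈R _ _ e∈r = there (∈-routingArcs⁺ r∈R e∈r)

  open Complement (×.≡-dec (_≟_ {ℕ.suc n}) (_≟_ {ℕ.suc n})) (E-unique n) public

  -- The set K of arcs deleted both before and after the merge.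
  common : List (Arc n)
  common = complement ((customer i , customer j) ∷ F)

  deleted-before : complement F ↭ (customer i , customer j) ∷ common
  deleted-before = complement-∷
    -- The bridge lies in `E` only if its ends differ; `i` equal to `j` would put `i` in `Rb`.
    (∈-E λ ci≡cj → i∉Rb (subst (_∈ toList Rb) (sym (suc-injective ci≡cj)) j∈Rb)) bridge∉F

  deleted-after : complement F′ ↭ (depot , customer j) ∷ (customer i , depot) ∷ common
  deleted-after = ↭-trans (complement-∷ (∈-E λ ()) first-arc∉F′) (↭-prep _ (↭-trans
    -- The second arc must be fresh for the first arc together with `F′`; the two arcs differ
    -- because only one of them starts at the depot.
    (complement-∷ (∈-E λ ()) λ where (there e∈F′) → last-arc∉F′ e∈F′)
    (↭-prep _ (↭-reflexive (complement-cong after⊆before before⊆after)))))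

-- Reduction to rational sums and the final computation.

-- Real addition and negation act termwise, so the identity can be proved exactly at each index,
-- without estimates.
≗⇒≈ : ∀ {x y} → (∀ k → seq x k ≡ seq y k) → x ≈ y
≗⇒≈ {x} {y} x≗y ε 0<ε = 0 , λ k _ → subst (ℚ._< ε)
  (sym (cong ℚ.∣_∣ (trans (cong (ℚ._- seq y k) (x≗y k)) (ℚ.+-inverseʳ (seq y k))))) 0<ε

module _ {n : ℕ} (W : Weight n) (k : ℕ) where
  open Weight W

  -- Working in `ℚ` makes addition commutative up to `≡`, and separating map from fold fits the
  -- permutation invariance of commutative-monoid folds.
  total : List (Arc n) → ℚ
  total = foldr ℚ._+_ 0ℚ ∘ List.map (λ (u , v) → seq (w u v) k)

  total-↭ : ∀ {es fs} → es ↭ fs → total es ≡ total fs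
  total-↭ es↭fs =
    foldr-commMonoid (setoid ℚ) ℚ.+-0-isCommutativeMonoid (↭⇒↭ₛ (map⁺ _ es↭fs))

  seq-sum : ∀ es → seq (foldr (λ e acc → w (proj₁ e) (proj₂ e) + acc) 0ℝ es) k ≡ total es
  seq-sum []       = refl
  seq-sum (e ∷ es) = cong (seq (w (proj₁ e) (proj₂ e)) k ℚ.+_) (seq-sum es)

theorem2 : ∀ (n : ℕ) (W : Weight n) (R : Routes n) → VisitsEachOnce R →
    ∀ (Ra Rb : Route n) → Ra ∈ R → Rb ∈ R → Ra ≢ Rb →
    ∀ (i j : Customer n) → last Ra ≡ i → head Rb ≡ j →
    let open Weight W in
    (ΔGED W R (mergeIn R Ra Rb) ≈ w (customer i) depot + w depot (customer j) - w (customer i) (customer j))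
    × (w (customer i) depot + w depot (customer j) - w (customer i) (customer j) ≈ saving W (customer i) (customer j))
theorem2 n W R once Ra Rb Ra∈R Rb∈R Ra≢Rb i j refl refl =
    ≗⇒≈ {ΔGED W R (mergeIn R Ra Rb)} {saving W (customer i) (customer j)} Δ≗saving
  , ≗⇒≈ {saving W (customer i) (customer j)} {saving W (customer i) (customer j)} (λ _ → refl)
  where
  open Weight W
  open MergedArcs once Ra∈R Rb∈R Ra≢Rb using (F; F′; common; complement; deleted-before; deleted-after)
  open ≡-Reasoning
  open +-*-Solver
  Δ≗saving : ∀ k → seq (ΔGED W R (mergeIn R Ra Rb)) k ≡ seq (saving W (customer i) (customer j)) k
  Δ≗saving k = begin
    seq (GED W F′) k ℚ.- seq (GED W F) k
      -- `GED` filters `E n` by the very test used in `complement`, so both sums become `total` over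
      -- permuted lists sharing `common`.
      ≡⟨ cong₂ ℚ._-_ (trans (seq-sum W k (complement F′)) (total-↭ W k deleted-after))
                     (trans (seq-sum W k (complement F)) (total-↭ W k deleted-before)) ⟩
    (b ℚ.+ (a ℚ.+ total W k common)) ℚ.- (x ℚ.+ total W k common)
      ≡⟨ solve 4 (λ a b x t → (b :+ (a :+ t)) :- (x :+ t) := (a :+ b) :- x) refl a b x _ ⟩
    a ℚ.+ b ℚ.- x ∎
    where
    a = seq (w (customer i) depot) k
    b = seq (w depot (customer j)) k
    x = seq (w (customer i) (customer j)) k
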